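{- For every integer $m\geq 2$, the sequence $\{i(i+1)\left(d_i^{2}(m)-d_{i-1}(m)d_{i+1}(m)\right)\}_{1\leq i \leq m}$ is log-concave.
   Context: For integers $m\ge 0$ and $0\le i\le m$, the Boros-Moll numbers are $$d_i(m)=2^{ -2m}\sum_{k=i}^m 2^k\binom{2m-2k}{m-k}\binom{m+k}{k}\binom{k}{i},$$ with the convention $d_i(m)=0$ for $i<0$ or $i>m$. The notation $d_i^{2}(m)$ means $(d_i(m))^2$. A finite real sequence is log-concave if each term squared is at least the product of its two neighbouring terms, where terms outside the index range are taken to be $0$. -}

module Defs where

open import Data.Fin.Base using (Fin; toℕ; fromℕ<)
open import Data.Integer.Base as ℤ using (ℤ; +_; -[1+_])
open import Data.List.Base using (applyUpTo)
open import Data.Nat.Base as ℕ using (ℕ; suc; _^_; _∸_)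
open import Data.Nat.Combinatorics using (_C_)
open import Data.Nat.ListAction using (sum)
open import Data.Nat.Properties using (_<?_; m^n≢0)
open import Data.Rational.Base using (ℚ; 0ℚ; _/_; _-_; _*_; _≥_)
open import Data.Vec.Functional using (Vector)
open import Relation.Nullary.Decidable.Core using (yes; no)

-- Every summand is a natural number, so only the factor 2^(-2m) leaves ℕ.
-- The list runs over k = i + j with 0 ≤ j < m + 1 ∸ i, that is i ≤ k ≤ m;
-- it is empty for i > m, which gives the convention d i m = 0 there.
-- For i ≤ k ≤ m all truncated subtractions below are exact.
d : ℤ → ℕ → ℚ
d -[1+ _ ] m = 0ℚ
d (+ i)    m = + sum (applyUpTo (λ j → term (i ℕ.+ j)) (suc m ∸ i)) / 2 ^ (2 ℕ.* m)
  where
  instance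
    2^2m≢0 : ℕ.NonZero (2 ^ (2 ℕ.* m))
    2^2m≢0 = m^n≢0 2 (2 ℕ.* m)

  term : ℕ → ℕ
  term k = 2 ^ k
    ℕ.* ((2 ℕ.* m ∸ 2 ℕ.* k) C (m ∸ k))
    ℕ.* ((m ℕ.+ k) C k)
    ℕ.* (k C i)

extendByZero : ∀ {n} → Vector ℚ n → ℤ → ℚ
extendByZero     a -[1+ _ ] = 0ℚ
extendByZero {n} a (+ k) with k <? n
... | yes k<n = a (fromℕ< k<n)
... | no  _   = 0ℚ

LogConcave : ∀ {n} → Vector ℚ n → Set
LogConcave {n} a = (j : Fin n) →
  a j * a j ≥ extendByZero a (ℤ.pred (+ toℕ j)) * extendByZero a (ℤ.suc (+ toℕ j))

-- The sequence is indexed by 1 ≤ i ≤ m; position j of the vector holds the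
-- entry with i = j + 1.
weightedTurán : (m : ℕ) → Vector ℚ m
weightedTurán m j =
  ((i ℤ.* ℤ.suc i) / 1) * (d i m * d i m - d (ℤ.pred i) m * d (ℤ.suc i) m)
  where
  i : ℤ
  i = + suc (toℕ j)

{-# OPTIONS --safe #-}

-- At fixed m the numbers d_i satisfy
--   i (i+1) d_{i+1} = (2m+1) i d_i - k (2m+1-k) d_{i-1},   k = m + 1 - i,
-- which follows by summing a telescoping identity for the terms of the defining
-- sum. Write i d_i = (k - e) d_{i-1}. Descending from d_{m+1} = 0, the recurrence
-- gives e = k (1 + e') / (2i + k + e'), where e' belongs to i + 1, and hence e ≥ 0
-- and s := k - e² - 2 i e ≥ 0. By the recurrence, the log-concavity inequality at
-- i = j + 2 is Q ≥ 0 for a polynomial Q in e, k, j; substituting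
-- k = e² + 2 i e + s turns Q into a polynomial in e, s, j all of whose
-- coefficients are nonnegative.
module Submission where

open import Defs
open import Algebra.Bundles using (RawRing)
import Algebra.Solver.Ring
open import Algebra.Solver.Ring.AlmostCommutativeRing
  using (fromCommutativeRing; _-Raw-AlmostCommutative⟶_)
open import Data.Bool.Base using (Bool; true; false; T; _∧_)
open import Data.Bool.Properties using (T-∧)
open import Data.Fin.Base using (toℕ; fromℕ<)
open import Data.Fin.Patterns
open import Data.Fin.Properties using (toℕ-fromℕ<; toℕ<n)
open import Data.Integer.Base as ℤ using (ℤ; +_; -[1+_])
import Data.Integer.Properties as ℤ
open import Data.List.Base using (applyUpTo; []; _∷_; _∷ʳ_)
open import Data.List.Properties using (applyUpTo-∷ʳ)
open import Data.Maybe.Base using (Maybe; just; nothing)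
open import Data.Nat.Base as ℕ using (ℕ; zero; suc; _^_; _∸_; _≥_; z≤n; s≤s)
open import Data.Nat.Combinatorics
  using (_C_; nC1≡n; nCk+nC[k+1]≡[n+1]C[k+1]; nCk≡nC[n∸k]; k>n⇒nCk≡0)
open import Data.Nat.ListAction using (sum)
open import Data.Nat.ListAction.Properties using (sum-++)
import Data.Nat.Properties as ℕ
import Data.Nat.Solver
open import Data.Product.Base using (_,_)
open import Data.Rational.Base hiding (_≥_)
open import Data.Rational.Properties
open import Data.Rational.Unnormalised.Base as ℚᵘ using (mkℚᵘ; *≡*)
import Data.Rational.Unnormalised.Properties as ℚᵘ
open import Data.Sum.Base using (inj₁; inj₂)
open import Data.Vec.Base using ([]; _∷_)
open import Data.Vec.Functional using (Vector)
open import Data.Vec.Relation.Unary.All using (All; []; _∷_)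
open import Function.Base using (_∘_)
open import Function.Bundles using (Equivalence)
open import Relation.Binary.PropositionalEquality
open import Relation.Nullary.Decidable using (yes; no)
open import Relation.Nullary.Negation using (contradiction)

module N = Data.Nat.Solver.+-*-Solver

-- The ring embedding of the integers into the rationals, and a ring solver over it.

ι : ℤ → ℚ
ι z = z / 1

private
  toℚᵘ-ι : ∀ z → toℚᵘ (ι z) ℚᵘ.≃ mkℚᵘ z 0
  toℚᵘ-ι z = toℚᵘ-fromℚᵘ (mkℚᵘ z 0)

ι-+ : ∀ x y → ι (x ℤ.+ y) ≡ ι x + ι y
ι-+ x y = toℚᵘ-injective (begin
  toℚᵘ (ι (x ℤ.+ y))            ≈⟨ toℚᵘ-ι (x ℤ.+ y) ⟩
  mkℚᵘ (x ℤ.+ y) 0              ≈⟨ *≡* (cong (ℤ._* + 1) (sym (cong₂ ℤ._+_ (ℤ.*-identityʳ x) (ℤ.*-identityʳ y)))) ⟩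
  mkℚᵘ x 0 ℚᵘ.+ mkℚᵘ y 0        ≈⟨ ℚᵘ.+-cong (toℚᵘ-ι x) (toℚᵘ-ι y) ⟨
  toℚᵘ (ι x) ℚᵘ.+ toℚᵘ (ι y)    ≈⟨ toℚᵘ-homo-+ (ι x) (ι y) ⟨
  toℚᵘ (ι x + ι y)              ∎)
  where open ℚᵘ.≃-Reasoning

ι-* : ∀ x y → ι (x ℤ.* y) ≡ ι x * ι y
ι-* x y = toℚᵘ-injective (begin
  toℚᵘ (ι (x ℤ.* y))            ≈⟨ toℚᵘ-ι (x ℤ.* y) ⟩
  mkℚᵘ x 0 ℚᵘ.* mkℚᵘ y 0        ≈⟨ ℚᵘ.*-cong (toℚᵘ-ι x) (toℚᵘ-ι y) ⟨
  toℚᵘ (ι x) ℚᵘ.* toℚᵘ (ι y)    ≈⟨ toℚᵘ-homo-* (ι x) (ι y) ⟨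
  toℚᵘ (ι x * ι y)              ∎)
  where open ℚᵘ.≃-Reasoning

ι-neg : ∀ x → ι (ℤ.- x) ≡ - ι x
ι-neg x = toℚᵘ-injective (begin
  toℚᵘ (ι (ℤ.- x))    ≈⟨ toℚᵘ-ι (ℤ.- x) ⟩
  ℚᵘ.- mkℚᵘ x 0       ≈⟨ ℚᵘ.-‿cong (toℚᵘ-ι x) ⟨
  ℚᵘ.- toℚᵘ (ι x)     ≈⟨ toℚᵘ-homo‿- (ι x) ⟨
  toℚᵘ (- ι x)        ∎)
  where open ℚᵘ.≃-Reasoning

-- The solver takes its coefficients in the integers, where the sign of a coefficient shows in its
-- constructor; the coefficient test below matches on it.
ℤ-rawRing : RawRing _ _
ℤ-rawRing = record
  { Carrier = ℤ ; _≈_ = _≡_ ; _+_ = ℤ._+_ ; _*_ = ℤ._*_ ; -_ = ℤ.-_ ; 0# = ℤ.0ℤ ; 1# = ℤ.1ℤ }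

ι-morphism : ℤ-rawRing -Raw-AlmostCommutative⟶ fromCommutativeRing +-*-commutativeRing
ι-morphism = record
  { ⟦_⟧ = ι ; +-homo = ι-+ ; *-homo = ι-* ; -‿homo = ι-neg ; 0-homo = refl ; 1-homo = refl }

ι-≟ : (x y : ℤ) → Maybe (ι x ≡ ι y)
ι-≟ x y with x ℤ.≟ y
... | yes x≡y = just (cong ι x≡y)
... | no  _   = nothing

open Algebra.Solver.Ring
  ℤ-rawRing (fromCommutativeRing +-*-commutativeRing) ι-morphism ι-≟

-- Polynomials with nonnegative coefficients are nonnegative on nonnegative
-- arguments; the coefficients are read off the solver's Horner normal form.

0≤+ : ∀ {x y} → 0ℚ ≤ x → 0ℚ ≤ y → 0ℚ ≤ x + y
0≤+ = +-mono-≤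

0≤* : ∀ {x y} → 0ℚ ≤ x → 0ℚ ≤ y → 0ℚ ≤ x * y
0≤* {x} {y} 0≤x 0≤y = subst (_≤ x * y) (*-zeroʳ x) (*-monoˡ-≤-nonNeg x ⦃ nonNegative 0≤x ⦄ 0≤y)

0≤ι : ∀ n → 0ℚ ≤ ι (+ n)
0≤ι n = toℚᵘ-cancel-≤ (ℚᵘ.≤-respʳ-≃ (ℚᵘ.≃-sym (toℚᵘ-ι (+ n))) (ℚᵘ.nonNegative⁻¹ (mkℚᵘ (+ n) 0)))

mutual
  nonNegH : ∀ {n} → HNF (suc n) → Bool
  nonNegH ∅         = true
  nonNegH (p *x+ c) = nonNegH p ∧ nonNegN c

  nonNegN : ∀ {n} → Normal n → Bool
  nonNegN (con (+ _))    = true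
  nonNegN (con -[1+ _ ]) = false
  nonNegN (poly p)       = nonNegH p

mutual
  0≤⟦_⟧H : ∀ {n} (p : HNF (suc n)) → T (nonNegH p) → ∀ {ρ} → All (0ℚ ≤_) ρ → 0ℚ ≤ ⟦ p ⟧H ρ
  0≤⟦ ∅       ⟧H _ _            = ≤-refl
  0≤⟦ p *x+ c ⟧H t (0≤x ∷ 0≤ρ) =
    let tp , tc = Equivalence.to T-∧ t in
    0≤+ (0≤* (0≤⟦ p ⟧H tp (0≤x ∷ 0≤ρ)) 0≤x) (0≤⟦ c ⟧N tc 0≤ρ)

  0≤⟦_⟧N : ∀ {n} (p : Normal n) → T (nonNegN p) → ∀ {ρ} → All (0ℚ ≤_) ρ → 0ℚ ≤ ⟦ p ⟧N ρ
  0≤⟦ con (+ n) ⟧N _ _   = 0≤ι n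
  0≤⟦ poly p    ⟧N t 0≤ρ = 0≤⟦ p ⟧H t 0≤ρ

-- For a concrete `p` the implicit argument computes to the unit type and is filled in by
-- unification, so each use is a proof by expansion of `p`.
0≤⟦_⟧ : ∀ {n} (p : Polynomial n) {_ : T (nonNegN (normalise p))} →
        ∀ {ρ} → All (0ℚ ≤_) ρ → 0ℚ ≤ ⟦ p ⟧ ρ
0≤⟦ p ⟧ {t} {ρ} 0≤ρ = subst (0ℚ ≤_) (correct p ρ) (0≤⟦ normalise p ⟧N t 0≤ρ)

-- Binomial coefficients

[1+k]*[1+n]C[1+k] : ∀ n k → suc k ℕ.* (suc n C suc k) ≡ suc n ℕ.* (n C k)
[1+k]*[1+n]C[1+k] zero    zero    = refl
[1+k]*[1+n]C[1+k] zero    (suc k) = ℕ.*-zeroʳ (suc (suc k))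
[1+k]*[1+n]C[1+k] (suc n) zero    = trans (ℕ.*-identityˡ _) (trans (nC1≡n (suc (suc n))) (sym (ℕ.*-identityʳ _)))
[1+k]*[1+n]C[1+k] (suc n) (suc k) = begin
  suc (suc k) ℕ.* (suc (suc n) C suc (suc k))
    ≡⟨ cong (suc (suc k) ℕ.*_) (nCk+nC[k+1]≡[n+1]C[k+1] (suc n) (suc k)) ⟨
  suc (suc k) ℕ.* (c ℕ.+ (suc n C suc (suc k)))
    ≡⟨ N.solve 3 (λ k c c′ → (N.con 2 N.:+ k) N.:* (c N.:+ c′) N.:= c N.:+ (N.con 1 N.:+ k) N.:* c N.:+ (N.con 2 N.:+ k) N.:* c′)
         refl k c (suc n C suc (suc k)) ⟩
  c ℕ.+ suc k ℕ.* c ℕ.+ suc (suc k) ℕ.* (suc n C suc (suc k))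
    ≡⟨ cong₂ (λ x y → c ℕ.+ x ℕ.+ y) ([1+k]*[1+n]C[1+k] n k) ([1+k]*[1+n]C[1+k] n (suc k)) ⟩
  c ℕ.+ suc n ℕ.* (n C k) ℕ.+ suc n ℕ.* (n C suc k)
    ≡⟨ ℕ.+-assoc c _ _ ⟩
  c ℕ.+ (suc n ℕ.* (n C k) ℕ.+ suc n ℕ.* (n C suc k))
    ≡⟨ cong (c ℕ.+_) (ℕ.*-distribˡ-+ (suc n) (n C k) (n C suc k)) ⟨
  c ℕ.+ suc n ℕ.* ((n C k) ℕ.+ (n C suc k))
    ≡⟨ cong (λ x → c ℕ.+ suc n ℕ.* x) (nCk+nC[k+1]≡[n+1]C[k+1] n k) ⟩
  suc (suc n) ℕ.* c ∎
  where
  open ≡-Reasoning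
  c = suc n C suc k

-- This is (n - k) C(n,k) = (k + 1) C(n,k+1) with the subtraction moved across, which makes it valid
-- for k > n as well.
[1+k]*nC[1+k]+k*nCk : ∀ n k → suc k ℕ.* (n C suc k) ℕ.+ k ℕ.* (n C k) ≡ n ℕ.* (n C k)
[1+k]*nC[1+k]+k*nCk zero    zero    = refl
[1+k]*nC[1+k]+k*nCk zero    (suc k) = cong₂ ℕ._+_ (ℕ.*-zeroʳ (suc (suc k))) (ℕ.*-zeroʳ (suc k))
[1+k]*nC[1+k]+k*nCk (suc n) zero    = begin
  1 ℕ.* (suc n C 1) ℕ.+ 0   ≡⟨ ℕ.+-identityʳ _ ⟩
  1 ℕ.* (suc n C 1)         ≡⟨ [1+k]*[1+n]C[1+k] n 0 ⟩
  suc n ℕ.* 1               ∎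
  where open ≡-Reasoning
[1+k]*nC[1+k]+k*nCk (suc n) (suc k) = begin
  suc (suc k) ℕ.* (suc n C suc (suc k)) ℕ.+ suc k ℕ.* (suc n C suc k)
    ≡⟨ cong₂ ℕ._+_ ([1+k]*[1+n]C[1+k] n (suc k)) ([1+k]*[1+n]C[1+k] n k) ⟩
  suc n ℕ.* (n C suc k) ℕ.+ suc n ℕ.* (n C k)
    ≡⟨ ℕ.+-comm (suc n ℕ.* (n C suc k)) _ ⟩
  suc n ℕ.* (n C k) ℕ.+ suc n ℕ.* (n C suc k)
    ≡⟨ ℕ.*-distribˡ-+ (suc n) (n C k) (n C suc k) ⟨
  suc n ℕ.* ((n C k) ℕ.+ (n C suc k))
    ≡⟨ cong (suc n ℕ.*_) (nCk+nC[k+1]≡[n+1]C[k+1] n k) ⟩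
  suc n ℕ.* (suc n C suc k) ∎
  where open ≡-Reasoning

-- Two absorptions lead down from C(2n+2,n+1) to C(2n,n), with the symmetry C(2n+1,n) = C(2n+1,n+1)
-- in between. Each consumes a factor n + 1, hence the multiplication by a second one that is
-- cancelled at the end.
[1+n]*[2+2n]C[1+n] : ∀ n → suc n ℕ.* ((2 ℕ.* suc n) C suc n) ≡ 2 ℕ.* suc (2 ℕ.* n) ℕ.* ((2 ℕ.* n) C n)
[1+n]*[2+2n]C[1+n] n = ℕ.*-cancelˡ-≡ _ _ (suc n) (begin
  suc n ℕ.* (suc n ℕ.* ((2 ℕ.* suc n) C suc n))
    ≡⟨ cong (λ x → suc n ℕ.* (suc n ℕ.* (x C suc n))) (ℕ.*-suc 2 n) ⟩
  suc n ℕ.* (suc n ℕ.* (suc (suc (2 ℕ.* n)) C suc n))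
    ≡⟨ cong (suc n ℕ.*_) ([1+k]*[1+n]C[1+k] (suc (2 ℕ.* n)) n) ⟩
  suc n ℕ.* (suc (suc (2 ℕ.* n)) ℕ.* (suc (2 ℕ.* n) C n))
    ≡⟨ cong (λ x → suc n ℕ.* (suc (suc (2 ℕ.* n)) ℕ.* x)) symmetric ⟩
  suc n ℕ.* (suc (suc (2 ℕ.* n)) ℕ.* (suc (2 ℕ.* n) C suc n))
    ≡⟨ N.solve 2 (λ n c → (N.con 1 N.:+ n) N.:* ((N.con 2 N.:+ N.con 2 N.:* n) N.:* c)
                      N.:= (N.con 2 N.:+ N.con 2 N.:* n) N.:* ((N.con 1 N.:+ n) N.:* c))
         refl n (suc (2 ℕ.* n) C suc n) ⟩
  suc (suc (2 ℕ.* n)) ℕ.* (suc n ℕ.* (suc (2 ℕ.* n) C suc n))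
    ≡⟨ cong (suc (suc (2 ℕ.* n)) ℕ.*_) ([1+k]*[1+n]C[1+k] (2 ℕ.* n) n) ⟩
  suc (suc (2 ℕ.* n)) ℕ.* (suc (2 ℕ.* n) ℕ.* ((2 ℕ.* n) C n))
    ≡⟨ N.solve 2 (λ n c → (N.con 2 N.:+ N.con 2 N.:* n) N.:* ((N.con 1 N.:+ N.con 2 N.:* n) N.:* c)
                      N.:= (N.con 1 N.:+ n) N.:* (N.con 2 N.:* (N.con 1 N.:+ N.con 2 N.:* n) N.:* c))
         refl n ((2 ℕ.* n) C n) ⟩
  suc n ℕ.* (2 ℕ.* suc (2 ℕ.* n) ℕ.* ((2 ℕ.* n) C n)) ∎)
  where
  open ≡-Reasoning
  1+2n : suc (2 ℕ.* n) ≡ n ℕ.+ suc n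
  1+2n = N.solve 1 (λ n → N.con 1 N.:+ N.con 2 N.:* n N.:= n N.:+ (N.con 1 N.:+ n)) refl n
  symmetric : suc (2 ℕ.* n) C n ≡ suc (2 ℕ.* n) C suc n
  symmetric = trans (nCk≡nC[n∸k] (ℕ.≤-trans (ℕ.m≤m+n n (suc n)) (ℕ.≤-reflexive (sym 1+2n))))
    (cong (suc (2 ℕ.* n) C_) (trans (cong (_∸ n) 1+2n) (ℕ.m+n∸m≡n n (suc n))))

-- Naturals as rationals, and finite sums.

ν : ℕ → ℚ
ν n = ι (+ n)

ν-suc : ∀ n → ν (suc n) ≡ ν 1 + ν n
ν-suc n = ι-+ (+ 1) (+ n)

ν-+ : ∀ m n → ν (m ℕ.+ n) ≡ ν m + ν n
ν-+ m n = ι-+ (+ m) (+ n)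

ν-* : ∀ m n → ν (m ℕ.* n) ≡ ν m * ν n
ν-* m n = trans (cong ι (ℤ.pos-* m n)) (ι-* (+ m) (+ n))

sum-applyUpTo-suc : ∀ f n → sum (applyUpTo f (suc n)) ≡ sum (applyUpTo f n) ℕ.+ f n
sum-applyUpTo-suc f n = begin
  sum (applyUpTo f (suc n))               ≡⟨ cong sum (applyUpTo-∷ʳ f n) ⟨
  sum (applyUpTo f n ∷ʳ f n)              ≡⟨ sum-++ (applyUpTo f n) (f n ∷ []) ⟩
  sum (applyUpTo f n) ℕ.+ (f n ℕ.+ 0)     ≡⟨ cong (sum (applyUpTo f n) ℕ.+_) (ℕ.+-identityʳ (f n)) ⟩
  sum (applyUpTo f n) ℕ.+ f n             ∎
  where open ≡-Reasoning

-- The sum defining `d` starts at k = i. Since C(k,i) = 0 for k < i, it may start at 0 instead, and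
-- then the sums for consecutive i share one range and can be compared term by term.
sum-applyUpTo-drop : ∀ f i n → (∀ k → k ℕ.< i → f k ≡ 0) →
  sum (applyUpTo (f ∘ (i ℕ.+_)) (n ∸ i)) ≡ sum (applyUpTo f n)
sum-applyUpTo-drop f zero    n       _  = refl
sum-applyUpTo-drop f (suc i) zero    _  = refl
sum-applyUpTo-drop f (suc i) (suc n) f≡0 =
  trans (sum-applyUpTo-drop (f ∘ suc) i n (λ k k<i → f≡0 (suc k) (s≤s k<i)))
        (cong (ℕ._+ sum (applyUpTo (f ∘ suc) n)) (sym (f≡0 0 (s≤s z≤n))))

+n/d : ∀ n d .⦃ _ : ℕ.NonZero d ⦄ → + n / d ≡ ν n * (+ 1 / d)
+n/d n (suc d) = toℚᵘ-injective (begin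
  toℚᵘ (+ n / suc d)                  ≈⟨ toℚᵘ-fromℚᵘ (mkℚᵘ (+ n) d) ⟩
  mkℚᵘ (+ n) d                        ≈⟨ *≡* (cong₂ ℤ._*_ (sym (ℤ.*-identityʳ (+ n))) (cong +_ (ℕ.+-identityʳ (suc d)))) ⟩
  mkℚᵘ (+ n) 0 ℚᵘ.* mkℚᵘ (+ 1) d      ≈⟨ ℚᵘ.*-cong (toℚᵘ-fromℚᵘ (mkℚᵘ (+ n) 0)) (toℚᵘ-fromℚᵘ (mkℚᵘ (+ 1) d)) ⟨
  toℚᵘ (ν n) ℚᵘ.* toℚᵘ (+ 1 / suc d)  ≈⟨ toℚᵘ-homo-* (ν n) (+ 1 / suc d) ⟨
  toℚᵘ (ν n * (+ 1 / suc d))          ∎)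
  where
  open ℚᵘ.≃-Reasoning

-- The three-term recurrence in i of the Boros-Moll numbers.

module BorosMoll (m : ℕ) where

  coeff : ℕ → ℕ
  coeff k = 2 ^ k ℕ.* ((2 ℕ.* m ∸ 2 ℕ.* k) C (m ∸ k)) ℕ.* ((m ℕ.+ k) C k)

  partial : ℕ → ℕ → ℕ
  partial i n = sum (applyUpTo (λ k → coeff k ℕ.* (k C i)) n)

  scale : ℚ
  scale = (+ 1 / 2 ^ (2 ℕ.* m)) ⦃ ℕ.m^n≢0 2 (2 ℕ.* m) ⦄

  private
    summand : ℕ → ℕ → ℕ
    summand i k = coeff k ℕ.* (k C i)

  d≡tail : ∀ i → d (+ i) m ≡ ν (sum (applyUpTo (summand i ∘ (i ℕ.+_)) (suc m ∸ i))) * scale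
  d≡tail i = +n/d (sum (applyUpTo (summand i ∘ (i ℕ.+_)) (suc m ∸ i))) (2 ^ (2 ℕ.* m)) ⦃ ℕ.m^n≢0 2 (2 ℕ.* m) ⦄

  d≡ : ∀ i → d (+ i) m ≡ ν (partial i (suc m)) * scale
  d≡ i = trans (d≡tail i) (cong (λ n → ν n * scale)
    (sum-applyUpTo-drop (summand i) i (suc m)
      (λ k k<i → trans (cong (coeff k ℕ.*_) (k>n⇒nCk≡0 k<i)) (ℕ.*-zeroʳ (coeff k)))))

  μ : ℚ
  μ = ν m

  -- `coeff` is hypergeometric: the quotient of consecutive values is 2 from the power of two, (n+1)
  -- / (2(2n+1)) with n = m-k-1 from the central binomial, and (m+k+1) / (k+1) from the last factor.
  -- The denominators are multiplied out.
  coeff-suc : ∀ k → k ℕ.< m →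
    ν (suc k) * (ν 2 * (μ - ν k) - ν 1) * ν (coeff (suc k)) ≡ (μ - ν k) * (ν 1 + μ + ν k) * ν (coeff k)
  coeff-suc k k<m = begin
    ν (suc k) * (ν 2 * (μ - ν k) - ν 1) * ν (coeff (suc k))
      ≡⟨ cong₂ (λ x y → ν (suc k) * (ν 2 * x - ν 1) * y) μ-k coeff₁ ⟩
    ν (suc k) * (ν 2 * (ν 1 + ν n) - ν 1) * (ν 2 * p * b * c₁)
      ≡⟨ solve 5 (λ K n p b c₁ → K :* (con (+ 2) :* (con (+ 1) :+ n) :- con (+ 1)) :* (con (+ 2) :* p :* b :* c₁)
           := p :* (con (+ 2) :* (con (+ 1) :+ con (+ 2) :* n) :* b) :* (K :* c₁)) refl (ν (suc k)) (ν n) p b c₁ ⟩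
    p * (ν 2 * (ν 1 + ν 2 * ν n) * b) * (ν (suc k) * c₁)
      ≡⟨ cong₂ (λ x y → p * x * y) central shifted ⟩
    p * ((ν 1 + ν n) * b₀) * ((ν 1 + μ + ν k) * c₀)
      ≡⟨ solve 6 (λ p n b₀ μ k c₀ → p :* ((con (+ 1) :+ n) :* b₀) :* ((con (+ 1) :+ μ :+ k) :* c₀)
           := (con (+ 1) :+ n) :* (con (+ 1) :+ μ :+ k) :* (p :* b₀ :* c₀)) refl p (ν n) b₀ μ (ν k) c₀ ⟩
    (ν 1 + ν n) * (ν 1 + μ + ν k) * (p * b₀ * c₀)
      ≡⟨ cong₂ (λ x y → x * (ν 1 + μ + ν k) * y) μ-k coeff₀ ⟨
    (μ - ν k) * (ν 1 + μ + ν k) * ν (coeff k) ∎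
    where
    open ≡-Reasoning
    n = m ∸ suc k
    p = ν (2 ^ k)
    b = ν ((2 ℕ.* n) C n)
    b₀ = ν ((2 ℕ.* suc n) C suc n)
    c₀ = ν ((m ℕ.+ k) C k)
    c₁ = ν ((m ℕ.+ suc k) C suc k)
    m∸k : m ∸ k ≡ suc n
    m∸k = ℕ.+-∸-assoc 1 k<m
    μ-k : μ - ν k ≡ ν 1 + ν n
    μ-k = begin
      μ - ν k                        ≡⟨ cong (λ x → ν x - ν k) (ℕ.m+[n∸m]≡n (ℕ.<⇒≤ k<m)) ⟨
      ν (k ℕ.+ (m ∸ k)) - ν k        ≡⟨ cong (λ x → ν (k ℕ.+ x) - ν k) m∸k ⟩
      ν (k ℕ.+ suc n) - ν k          ≡⟨ cong (_- ν k) (trans (ν-+ k (suc n)) (cong (λ y → ν k + y) (ν-suc n))) ⟩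
      ν k + (ν 1 + ν n) - ν k        ≡⟨ solve 2 (λ k n → k :+ (con (+ 1) :+ n) :- k := con (+ 1) :+ n) refl (ν k) (ν n) ⟩
      ν 1 + ν n                      ∎
    central : ν 2 * (ν 1 + ν 2 * ν n) * b ≡ (ν 1 + ν n) * b₀
    central = begin
      ν 2 * (ν 1 + ν 2 * ν n) * b                          ≡⟨ cong (λ x → ν 2 * x * b) (trans (ν-suc (2 ℕ.* n)) (cong (λ y → ν 1 + y) (ν-* 2 n))) ⟨
      ν 2 * ν (suc (2 ℕ.* n)) * b                          ≡⟨ cong (_* b) (ν-* 2 (suc (2 ℕ.* n))) ⟨
      ν (2 ℕ.* suc (2 ℕ.* n)) * b                          ≡⟨ ν-* (2 ℕ.* suc (2 ℕ.* n)) ((2 ℕ.* n) C n) ⟨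
      ν (2 ℕ.* suc (2 ℕ.* n) ℕ.* ((2 ℕ.* n) C n))          ≡⟨ cong ν ([1+n]*[2+2n]C[1+n] n) ⟨
      ν (suc n ℕ.* ((2 ℕ.* suc n) C suc n))                ≡⟨ ν-* (suc n) ((2 ℕ.* suc n) C suc n) ⟩
      ν (suc n) * b₀                                       ≡⟨ cong (_* b₀) (ν-suc n) ⟩
      (ν 1 + ν n) * b₀                                     ∎
    shifted : ν (suc k) * c₁ ≡ (ν 1 + μ + ν k) * c₀
    shifted = begin
      ν (suc k) * c₁                                   ≡⟨ ν-* (suc k) ((m ℕ.+ suc k) C suc k) ⟨
      ν (suc k ℕ.* ((m ℕ.+ suc k) C suc k))            ≡⟨ cong (λ x → ν (suc k ℕ.* (x C suc k))) (ℕ.+-suc m k) ⟩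
      ν (suc k ℕ.* (suc (m ℕ.+ k) C suc k))            ≡⟨ cong ν ([1+k]*[1+n]C[1+k] (m ℕ.+ k) k) ⟩
      ν (suc (m ℕ.+ k) ℕ.* ((m ℕ.+ k) C k))            ≡⟨ ν-* (suc (m ℕ.+ k)) ((m ℕ.+ k) C k) ⟩
      ν (suc (m ℕ.+ k)) * c₀                           ≡⟨ cong (_* c₀) (trans (ν-+ (suc m) k) (cong (_+ ν k) (ν-suc m))) ⟩
      (ν 1 + μ + ν k) * c₀                             ∎
    split : ∀ x y z → ν (x ℕ.* y ℕ.* z) ≡ ν x * ν y * ν z
    split x y z = trans (ν-* (x ℕ.* y) z) (cong (_* ν z) (ν-* x y))
    coeff₀ : ν (coeff k) ≡ p * b₀ * c₀
    coeff₀ = trans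
      (cong (λ x → ν (2 ^ k ℕ.* x ℕ.* ((m ℕ.+ k) C k)))
        (trans (cong (_C (m ∸ k)) (sym (ℕ.*-distribˡ-∸ 2 m k))) (cong (λ x → (2 ℕ.* x) C x) m∸k)))
      (split (2 ^ k) _ _)
    coeff₁ : ν (coeff (suc k)) ≡ ν 2 * p * b * c₁
    coeff₁ = trans
      (cong (λ x → ν (2 ^ suc k ℕ.* x ℕ.* ((m ℕ.+ suc k) C suc k)))
        (cong (_C n) (sym (ℕ.*-distribˡ-∸ 2 m (suc k)))))
      (trans (split (2 ^ suc k) _ _) (cong (λ x → x * b * c₁) (ν-* 2 (2 ^ k))))

  module _ (n : ℕ) where

    -- From the operator (a² - 1) ∂² + (2a + 2m + 1) ∂ - m(m+1) annihilating Σᵢ dᵢ aⁱ: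
    -- applied to coeff k · (a + 1)ᵏ it leaves a telescoping difference, whose
    -- coefficient of aⁿ is boundary k - boundary (suc k).
    boundary : ℕ → ℚ
    boundary zero    = ν 0
    boundary (suc k) = ν (coeff k) * (μ - ν k) * (ν 1 + μ + ν k) * ν (k C n)

    ν-absorb : ∀ k i → (ν 1 + ν i) * ν (k C suc i) ≡ (ν k - ν i) * ν (k C i)
    ν-absorb k i = begin
      (ν 1 + ν i) * c₁                                 ≡⟨ cong (_* c₁) (ν-suc i) ⟨
      ν (suc i) * c₁                                   ≡⟨ ν-* (suc i) (k C suc i) ⟨
      ν (suc i ℕ.* (k C suc i))                        ≡⟨ solve 2 (λ x y → x := x :+ y :- y) refl _ (ν (i ℕ.* (k C i))) ⟩
      ν (suc i ℕ.* (k C suc i)) + ν (i ℕ.* (k C i)) - ν (i ℕ.* (k C i))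
        ≡⟨ cong (_- ν (i ℕ.* (k C i))) (ν-+ (suc i ℕ.* (k C suc i)) (i ℕ.* (k C i))) ⟨
      ν (suc i ℕ.* (k C suc i) ℕ.+ i ℕ.* (k C i)) - ν (i ℕ.* (k C i))
        ≡⟨ cong (λ x → ν x - ν (i ℕ.* (k C i))) ([1+k]*nC[1+k]+k*nCk k i) ⟩
      ν (k ℕ.* (k C i)) - ν (i ℕ.* (k C i))            ≡⟨ cong₂ _-_ (ν-* k (k C i)) (ν-* i (k C i)) ⟩
      ν k * c - ν i * c                                ≡⟨ solve 3 (λ k i c → k :* c :- i :* c := (k :- i) :* c) refl (ν k) (ν i) c ⟩
      (ν k - ν i) * c                                  ∎
      where
      open ≡-Reasoning
      c = ν (k C i)
      c₁ = ν (k C suc i)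

    -- `boundary (suc k)` is defined through `coeff k`. The quotient of consecutive coefficients and
    -- absorption express it through `coeff (suc k)`, so that each inductive step of the summation
    -- involves a single coefficient.
    boundary-≤ : ∀ k → k ℕ.≤ m →
      boundary k ≡ ν (coeff k) * (ν 1 + ν 2 * (μ - ν k)) * ((ν k - ν n) * ν (k C n))
    boundary-≤ zero _ = sym (begin
      ν (coeff 0) * (ν 1 + ν 2 * (μ - ν 0)) * ((ν 0 - ν n) * ν (0 C n))
        ≡⟨ cong (ν (coeff 0) * (ν 1 + ν 2 * (μ - ν 0)) *_) (ν-absorb 0 n) ⟨
      ν (coeff 0) * (ν 1 + ν 2 * (μ - ν 0)) * ((ν 1 + ν n) * ν 0)
        ≡⟨ solve 2 (λ x y → x :* (y :* con (+ 0)) := con (+ 0)) refl (ν (coeff 0) * (ν 1 + ν 2 * (μ - ν 0))) (ν 1 + ν n) ⟩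
      ν 0 ∎)
      where open ≡-Reasoning
    boundary-≤ (suc k) k<m = begin
      ν (coeff k) * (μ - ν k) * (ν 1 + μ + ν k) * c
        ≡⟨ solve 4 (λ t x y c → t :* x :* y :* c := x :* y :* t :* c) refl (ν (coeff k)) (μ - ν k) (ν 1 + μ + ν k) c ⟩
      (μ - ν k) * (ν 1 + μ + ν k) * ν (coeff k) * c
        ≡⟨ cong (_* c) (coeff-suc k k<m) ⟨
      ν (suc k) * (ν 2 * (μ - ν k) - ν 1) * t₁ * c
        ≡⟨ solve 4 (λ K x t c → K :* (con (+ 2) :* x :- con (+ 1)) :* t :* c := t :* (con (+ 2) :* x :- con (+ 1)) :* (K :* c))
             refl (ν (suc k)) (μ - ν k) t₁ c ⟩
      t₁ * (ν 2 * (μ - ν k) - ν 1) * (ν (suc k) * c)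
        ≡⟨ cong₂ (λ x y → t₁ * x * y)
             (solve 2 (λ μ k → con (+ 2) :* (μ :- k) :- con (+ 1) := con (+ 1) :+ con (+ 2) :* (μ :- (con (+ 1) :+ k))) refl μ (ν k))
             absorb ⟩
      t₁ * (ν 1 + ν 2 * (μ - (ν 1 + ν k))) * ((ν (suc k) - ν n) * ν (suc k C n))
        ≡⟨ cong (λ x → t₁ * (ν 1 + ν 2 * (μ - x)) * ((ν (suc k) - ν n) * ν (suc k C n))) (ν-suc k) ⟨
      t₁ * (ν 1 + ν 2 * (μ - ν (suc k))) * ((ν (suc k) - ν n) * ν (suc k C n)) ∎
      where
      open ≡-Reasoning
      c = ν (k C n)
      t₁ = ν (coeff (suc k))
      absorb : ν (suc k) * c ≡ (ν (suc k) - ν n) * ν (suc k C n)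
      absorb = begin
        ν (suc k) * c                          ≡⟨ ν-* (suc k) (k C n) ⟨
        ν (suc k ℕ.* (k C n))                  ≡⟨ cong ν ([1+k]*[1+n]C[1+k] k n) ⟨
        ν (suc n ℕ.* (suc k C suc n))          ≡⟨ ν-* (suc n) (suc k C suc n) ⟩
        ν (suc n) * ν (suc k C suc n)          ≡⟨ cong (_* ν (suc k C suc n)) (ν-suc n) ⟩
        (ν 1 + ν n) * ν (suc k C suc n)        ≡⟨ ν-absorb (suc k) n ⟩
        (ν (suc k) - ν n) * ν (suc k C n)      ∎

    Σ : ℕ → ℕ → ℚ
    Σ i K = ν (partial i K)

    Σ-suc : ∀ i K → Σ i (suc K) ≡ Σ i K + ν (coeff K) * ν (K C i)
    Σ-suc i K = trans (cong ν (sum-applyUpTo-suc (λ k → coeff k ℕ.* (k C i)) K))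
      (trans (ν-+ (partial i K) _) (cong (λ y → Σ i K + y) (ν-* (coeff K) (K C i))))

    -- The recurrence for the sums cut off at K, by induction on K; `boundary K` is what the
    -- telescoping leaves over.
    partial-recurrence : ∀ K → K ℕ.≤ suc m →
      (ν 1 + ν n) * (ν 2 + ν n) * Σ (2 ℕ.+ n) K ≡
      (ν 1 + ν 2 * μ) * (ν 1 + ν n) * Σ (suc n) K
        - (μ * (ν 1 + μ) - ν n * (ν 1 + ν n)) * Σ n K + boundary K
    partial-recurrence zero _ = solve 2 (λ μ n →
      (con (+ 1) :+ n) :* (con (+ 2) :+ n) :* con (+ 0) :=
      (con (+ 1) :+ con (+ 2) :* μ) :* (con (+ 1) :+ n) :* con (+ 0)
        :- (μ :* (con (+ 1) :+ μ) :- n :* (con (+ 1) :+ n)) :* con (+ 0) :+ con (+ 0)) refl μ (ν n)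
    partial-recurrence (suc k) (s≤s k≤m) = begin
      (ν 1 + ν n) * (ν 2 + ν n) * Σ (2 ℕ.+ n) (suc k)
        ≡⟨ cong ((ν 1 + ν n) * (ν 2 + ν n) *_) (Σ-suc (2 ℕ.+ n) k) ⟩
      (ν 1 + ν n) * (ν 2 + ν n) * (Σ (2 ℕ.+ n) k + t * c₂)
        ≡⟨ solve 4 (λ n x t c₂ → (con (+ 1) :+ n) :* (con (+ 2) :+ n) :* (x :+ t :* c₂) :=
             (con (+ 1) :+ n) :* (con (+ 2) :+ n) :* x :+ t :* ((con (+ 1) :+ n) :* ((con (+ 2) :+ n) :* c₂)))
             refl (ν n) (Σ (2 ℕ.+ n) k) t c₂ ⟩
      (ν 1 + ν n) * (ν 2 + ν n) * Σ (2 ℕ.+ n) k + t * ((ν 1 + ν n) * ((ν 2 + ν n) * c₂))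
        ≡⟨ cong₂ _+_ (trans (partial-recurrence k (ℕ.m≤n⇒m≤1+n k≤m)) (cong (λ y → α * Σ₁ - β * Σ₀ + y) (boundary-≤ k k≤m)))
             (cong (t *_) second) ⟩
      α * Σ₁ - β * Σ₀ + t * (ν 1 + ν 2 * (μ - ν k)) * ((ν k - ν n) * c₀) + t * ((ν k - (ν 1 + ν n)) * ((ν k - ν n) * c₀))
        -- Apart from the common factor `t * c₀` this is (k-n)(2m-k-n) = (2m+1)(k-n) - (m(m+1) -
        -- n(n+1)) + (m-k)(m+k+1).
        ≡⟨ solve 7 (λ μ n k t c₀ Σ₁ Σ₀ →
             let α = (con (+ 1) :+ con (+ 2) :* μ) :* (con (+ 1) :+ n)
                 β = μ :* (con (+ 1) :+ μ) :- n :* (con (+ 1) :+ n) in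
             α :* Σ₁ :- β :* Σ₀ :+ t :* (con (+ 1) :+ con (+ 2) :* (μ :- k)) :* ((k :- n) :* c₀)
               :+ t :* ((k :- (con (+ 1) :+ n)) :* ((k :- n) :* c₀)) :=
             α :* Σ₁ :+ t :* (con (+ 1) :+ con (+ 2) :* μ) :* ((k :- n) :* c₀) :- β :* (Σ₀ :+ t :* c₀)
               :+ t :* (μ :- k) :* (con (+ 1) :+ μ :+ k) :* c₀)
             refl μ (ν n) (ν k) t c₀ Σ₁ Σ₀ ⟩
      α * Σ₁ + t * (ν 1 + ν 2 * μ) * ((ν k - ν n) * c₀) - β * (Σ₀ + t * c₀) + boundary (suc k)
        ≡⟨ cong (λ x → α * Σ₁ + t * (ν 1 + ν 2 * μ) * x - β * (Σ₀ + t * c₀) + boundary (suc k)) (ν-absorb k n) ⟨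
      α * Σ₁ + t * (ν 1 + ν 2 * μ) * ((ν 1 + ν n) * c₁) - β * (Σ₀ + t * c₀) + boundary (suc k)
        ≡⟨ cong (λ x → x - β * (Σ₀ + t * c₀) + boundary (suc k))
             (solve 5 (λ x y Σ₁ t c₁ → x :* y :* Σ₁ :+ t :* x :* (y :* c₁) := x :* y :* (Σ₁ :+ t :* c₁))
               refl (ν 1 + ν 2 * μ) (ν 1 + ν n) Σ₁ t c₁) ⟩
      α * (Σ₁ + t * c₁) - β * (Σ₀ + t * c₀) + boundary (suc k)
        ≡⟨ cong₂ (λ x y → α * x - β * y + boundary (suc k)) (Σ-suc (suc n) k) (Σ-suc n k) ⟨
      α * Σ (suc n) (suc k) - β * Σ n (suc k) + boundary (suc k) ∎
      where
      open ≡-Reasoning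
      t = ν (coeff k)
      c₀ = ν (k C n)
      c₁ = ν (k C suc n)
      c₂ = ν (k C suc (suc n))
      Σ₀ = Σ n k
      Σ₁ = Σ (suc n) k
      α = (ν 1 + ν 2 * μ) * (ν 1 + ν n)
      β = μ * (ν 1 + μ) - ν n * (ν 1 + ν n)
      second : (ν 1 + ν n) * ((ν 2 + ν n) * c₂) ≡ (ν k - (ν 1 + ν n)) * ((ν k - ν n) * c₀)
      second = begin
        (ν 1 + ν n) * ((ν 2 + ν n) * c₂)
          ≡⟨ cong (λ x → (ν 1 + ν n) * (x * c₂))
               (trans (solve 1 (λ n → con (+ 2) :+ n := con (+ 1) :+ (con (+ 1) :+ n)) refl (ν n)) (cong (λ y → ν 1 + y) (sym (ν-suc n)))) ⟩
        (ν 1 + ν n) * ((ν 1 + ν (suc n)) * c₂)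
          ≡⟨ cong ((ν 1 + ν n) *_) (trans (ν-absorb k (suc n)) (cong (λ x → (ν k - x) * c₁) (ν-suc n))) ⟩
        (ν 1 + ν n) * ((ν k - (ν 1 + ν n)) * c₁)
          ≡⟨ solve 3 (λ x y z → x :* (y :* z) := y :* (x :* z)) refl (ν 1 + ν n) (ν k - (ν 1 + ν n)) c₁ ⟩
        (ν k - (ν 1 + ν n)) * ((ν 1 + ν n) * c₁)
          ≡⟨ cong ((ν k - (ν 1 + ν n)) *_) (ν-absorb k n) ⟩
        (ν k - (ν 1 + ν n)) * ((ν k - ν n) * c₀) ∎

  recurrence : ∀ n →
    (ν 1 + ν n) * (ν 2 + ν n) * d (+ (2 ℕ.+ n)) m ≡
    (ν 1 + ν 2 * μ) * (ν 1 + ν n) * d (+ suc n) m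
      - (μ * (ν 1 + μ) - ν n * (ν 1 + ν n)) * d (+ n) m
  recurrence n = begin
    a * d (+ (2 ℕ.+ n)) m                             ≡⟨ cong (a *_) (d≡ (2 ℕ.+ n)) ⟩
    a * (Σ₂ * scale)                                  ≡⟨ *-assoc a Σ₂ scale ⟨
    a * Σ₂ * scale                                    ≡⟨ cong (_* scale) (partial-recurrence n (suc m) ℕ.≤-refl) ⟩
    (α * Σ₁ - β * Σ₀ + boundary n (suc m)) * scale
      -- At the full range K = m + 1 the boundary term contains the factor m - m and vanishes.
      ≡⟨ solve 9 (λ α Σ₁ β Σ₀ t μ z c scale →
           (α :* Σ₁ :- β :* Σ₀ :+ t :* (μ :- μ) :* z :* c) :* scale := α :* (Σ₁ :* scale) :- β :* (Σ₀ :* scale))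
           refl α Σ₁ β Σ₀ (ν (coeff m)) μ (ν 1 + μ + μ) (ν (m C n)) scale ⟩
    α * (Σ₁ * scale) - β * (Σ₀ * scale)               ≡⟨ cong₂ (λ x y → α * x - β * y) (d≡ (suc n)) (d≡ n) ⟨
    α * d (+ suc n) m - β * d (+ n) m                 ∎
    where
    open ≡-Reasoning
    Σ₀ = ν (partial n (suc m))
    Σ₁ = ν (partial (suc n) (suc m))
    Σ₂ = ν (partial (2 ℕ.+ n) (suc m))
    a = (ν 1 + ν n) * (ν 2 + ν n)
    α = (ν 1 + ν 2 * μ) * (ν 1 + ν n)
    β = μ * (ν 1 + μ) - ν n * (ν 1 + ν n)

  -- The range of summation is empty. This starts the descent for the ratio.
  d[1+m]≡0 : d (+ suc m) m ≡ 0ℚ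
  d[1+m]≡0 = begin
    d (+ suc m) m                               ≡⟨ d≡tail (suc m) ⟩
    ν (sum (applyUpTo f (m ∸ m))) * scale       ≡⟨ cong (λ n → ν (sum (applyUpTo f n)) * scale) (ℕ.n∸n≡0 m) ⟩
    ν 0 * scale                                 ≡⟨ *-zeroˡ scale ⟩
    0ℚ                                          ∎
    where
    open ≡-Reasoning
    f = summand (suc m) ∘ (suc m ℕ.+_)

-- The quartic form and the bound on the ratio

-- Here x and y are i d_i / d_{i-1} and i (i+1) d_{i+1} / d_{i-1}, while S₋, S₀, S₊
-- are, up to positive factors, the terms i - 1, i, i + 1 of the sequence divided by
-- d_{i-1}², where i = j + 2.
module Forms {n} (e k j : Polynomial n) where
  one two i i₋ i₊ M x y c₋ c c₊ S₀ S₊ S₋ Q : Polynomial n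
  one = con (+ 1)
  two = con (+ 2)
  i₋ = one :+ j
  i = one :+ i₋
  i₊ = one :+ i
  M = two :* (i :+ k) :- one
  c₋ = (one :+ k) :* (M :- (one :+ k))
  c = k :* (M :- k)
  c₊ = (k :- one) :* (M :- (k :- one))
  x = k :- e
  y = M :* x :- c
  S₋ = i :* c₋ :- i₋ :* (M :- x) :* x
  S₀ = i₊ :* x :* x :- i :* y
  S₊ = (one :+ i₊) :* y :* y :- i₊ :* x :* (M :* y :- c₊ :* x)
  Q = i₊ :* c₋ :* (S₀ :* S₀) :- i₋ :* S₋ :* S₊

-- k = e² + 2 i e + s, in the variables e, s, j.
kᵖ : Polynomial 3
kᵖ = var 0F :* var 0F :+ con (+ 2) :* (con (+ 1) :+ (con (+ 1) :+ var 2F)) :* var 0F :+ var 1F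

-- The recurrence at I = N + 1 with m eliminated through K = m - N: then `M` is 2m + 1, and K (M -
-- K) is m(m+1) - N(N+1).
Recurrence : (N K p q r : ℚ) → Set
Recurrence N K p q r = I * (ν 1 + I) * r ≡ M * I * q - K * (M - K) * p
  where
  I = ν 1 + N
  M = ν 2 * (I + K) - ν 1

turán : (I a b c : ℚ) → ℚ
turán I a b c = I * (ν 1 + I) * (b * b - a * c)

0≤p-q⇒q≤p : ∀ {p q} → 0ℚ ≤ p - q → q ≤ p
0≤p-q⇒q≤p {p} {q} 0≤p-q = subst₂ _≤_ (+-identityˡ q)
  (solve 2 (λ p q → p :- q :+ q := p) refl p q) (+-monoˡ-≤ q 0≤p-q)

-- The coefficient test yields weak inequalities only; strict positivity is obtained by applying it
-- to p - 1.
0≤p-1⇒0<p : ∀ {p} → 0ℚ ≤ p - ν 1 → 0ℚ < p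
0≤p-1⇒0<p 0≤p-1 = <-≤-trans (positive⁻¹ (ν 1)) (0≤p-q⇒q≤p 0≤p-1)

0≤p*p : ∀ p → 0ℚ ≤ p * p
0≤p*p p with ≤-total 0ℚ p
... | inj₁ 0≤p = 0≤* 0≤p 0≤p
... | inj₂ p≤0 = subst (0ℚ ≤_) (solve 1 (λ p → (:- p) :* (:- p) := p :* p) refl p) (0≤* 0≤-p 0≤-p)
  where
  0≤-p : 0ℚ ≤ - p
  0≤-p = neg-antimono-≤ p≤0

-- The letters `t`, `u`, `v`, `w`, `z` stand for d_{i-2}, ..., d_{i+2}, where i = j + 2 and K = m +
-- 1 - i. The hypotheses turn each of them, after multiplication by a suitable factor, into a
-- multiple of `u`; no division by `u` takes place.
module _ {e K j t u v w z : ℚ}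
  (rec₋ : Recurrence j (ν 1 + K) t u v)
  (rec₀ : Recurrence (ν 1 + j) K u v w)
  (rec₊ : Recurrence (ν 1 + (ν 1 + j)) (K - ν 1) v w z)
  (ratio : (ν 1 + (ν 1 + j)) * v ≡ (K - e) * u)
  where

  private
    I₋ = ν 1 + j
    I = ν 1 + I₋
    I₊ = ν 1 + I
    eval : Polynomial 3 → ℚ
    eval p = ⟦ p ⟧ (e ∷ K ∷ j ∷ [])
    module F = Forms {3} (var 0F) (var 1F) (var 2F)
    module G = Forms {3} (var 0F) kᵖ (var 2F)
    open ≡-Reasoning

    w-form : I * I₊ * w ≡ eval F.y * u
    w-form = begin
      I * I₊ * w                                ≡⟨ rec₀ ⟩
      eval F.M * I * v - eval F.c * u           ≡⟨ cong (_- eval F.c * u) (trans (*-assoc (eval F.M) I v) (cong (eval F.M *_) ratio)) ⟩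
      eval F.M * ((K - e) * u) - eval F.c * u
        ≡⟨ solve 4 (λ M x c u → M :* (x :* u) :- c :* u := (M :* x :- c) :* u) refl (eval F.M) (K - e) (eval F.c) u ⟩
      eval F.y * u                              ∎

    z-form : I * (I₊ * (ν 1 + I₊) * z) ≡ (eval F.M * eval F.y - eval F.c₊ * eval F.x) * u
    z-form = begin
      I * (I₊ * (ν 1 + I₊) * z)   ≡⟨ cong (I *_) rec₊ ⟩
      I * ((ν 2 * (I₊ + (K - ν 1)) - ν 1) * I₊ * w - (K - ν 1) * ((ν 2 * (I₊ + (K - ν 1)) - ν 1) - (K - ν 1)) * v)
        -- All three recurrences have the same 2m + 1: raising the index and lowering `K` by one
        -- cancel in it.
        ≡⟨ solve 5 (λ e K j v w → let open Forms e K j; M′ = two :* (i₊ :+ (K :- one)) :- one in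
             i :* (M′ :* i₊ :* w :- (K :- one) :* (M′ :- (K :- one)) :* v) := M :* (i :* i₊ :* w) :- c₊ :* (i :* v)) refl e K j v w ⟩
      eval F.M * (I * I₊ * w) - eval F.c₊ * (I * v)
        ≡⟨ cong₂ (λ x y → eval F.M * x - eval F.c₊ * y) w-form ratio ⟩
      eval F.M * (eval F.y * u) - eval F.c₊ * (eval F.x * u)
        ≡⟨ solve 5 (λ M y c x u → M :* (y :* u) :- c :* (x :* u) := (M :* y :- c :* x) :* u) refl (eval F.M) (eval F.y) (eval F.c₊) (eval F.x) u ⟩
      (eval F.M * eval F.y - eval F.c₊ * eval F.x) * u ∎

    -- The recurrence solved for its lowest term, whose coefficient `c₋` stays on the left.
    t-form : eval F.c₋ * t ≡ I₋ * (eval F.M - eval F.x) * u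
    t-form = begin
      eval F.c₋ * t
        ≡⟨ solve 6 (λ e K j t u v → let open Forms e K j; M′ = two :* (i₋ :+ (one :+ K)) :- one in
             c₋ :* t := M′ :* i₋ :* u :- (M′ :* i₋ :* u :- (one :+ K) :* (M′ :- (one :+ K)) :* t)) refl e K j t u v ⟩
      M′ * I₋ * u - (M′ * I₋ * u - (ν 1 + K) * (M′ - (ν 1 + K)) * t)    ≡⟨ cong (λ x → M′ * I₋ * u - x) rec₋ ⟨
      M′ * I₋ * u - I₋ * I * v
        ≡⟨ solve 5 (λ e K j u v → let open Forms e K j; M′ = two :* (i₋ :+ (one :+ K)) :- one in
             M′ :* i₋ :* u :- i₋ :* i :* v := i₋ :* (M :* u :- i :* v)) refl e K j u v ⟩
      I₋ * (eval F.M * u - I * v)                                       ≡⟨ cong (λ x → I₋ * (eval F.M * u - x)) ratio ⟩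
      I₋ * (eval F.M * u - eval F.x * u)
        ≡⟨ solve 4 (λ I₋ M x u → I₋ :* (M :* u :- x :* u) := I₋ :* (M :- x) :* u) refl I₋ (eval F.M) (eval F.x) u ⟩
      I₋ * (eval F.M - eval F.x) * u ∎
      where M′ = ν 2 * (I₋ + (ν 1 + K)) - ν 1

    T₋ = turán I₋ t u v
    T₀ = turán I u v w
    T₊ = turán I₊ v w z

    S₀-form : I * T₀ ≡ eval F.S₀ * (u * u)
    S₀-form = begin
      I * T₀
        ≡⟨ solve 4 (λ I u v w → let I₊ = con (+ 1) :+ I in
             I :* (I :* I₊ :* (v :* v :- u :* w)) := I₊ :* (I :* v) :* (I :* v) :- I :* u :* (I :* I₊ :* w)) refl I u v w ⟩
      I₊ * (I * v) * (I * v) - I * u * (I * I₊ * w)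
        ≡⟨ cong₂ (λ p q → I₊ * p * p - I * u * q) ratio w-form ⟩
      I₊ * (eval F.x * u) * (eval F.x * u) - I * u * (eval F.y * u)
        ≡⟨ solve 5 (λ I₊ x I y u → I₊ :* (x :* u) :* (x :* u) :- I :* u :* (y :* u) :=
             (I₊ :* x :* x :- I :* y) :* (u :* u)) refl I₊ (eval F.x) I (eval F.y) u ⟩
      eval F.S₀ * (u * u) ∎

    S₊-form : I * I * I₊ * T₊ ≡ eval F.S₊ * (u * u)
    S₊-form = begin
      I * I * I₊ * T₊
        ≡⟨ solve 4 (λ I v w z → let I₊ = con (+ 1) :+ I; I₊₊ = con (+ 1) :+ I₊ in
             I :* I :* I₊ :* (I₊ :* I₊₊ :* (w :* w :- v :* z)) :=
             I₊₊ :* (I :* I₊ :* w) :* (I :* I₊ :* w) :- I₊ :* (I :* v) :* (I :* (I₊ :* I₊₊ :* z))) refl I v w z ⟩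
      (ν 1 + I₊) * (I * I₊ * w) * (I * I₊ * w) - I₊ * (I * v) * (I * (I₊ * (ν 1 + I₊) * z))
        ≡⟨ cong₂ (λ p q → (ν 1 + I₊) * p * p - I₊ * (I * v) * q) w-form z-form ⟩
      (ν 1 + I₊) * (eval F.y * u) * (eval F.y * u) - I₊ * (I * v) * (Z * u)
        ≡⟨ cong (λ p → (ν 1 + I₊) * (eval F.y * u) * (eval F.y * u) - I₊ * p * (Z * u)) ratio ⟩
      (ν 1 + I₊) * (eval F.y * u) * (eval F.y * u) - I₊ * (eval F.x * u) * (Z * u)
        ≡⟨ solve 6 (λ a I₊ x y Z u → a :* (y :* u) :* (y :* u) :- I₊ :* (x :* u) :* (Z :* u) :=
             (a :* y :* y :- I₊ :* x :* Z) :* (u :* u)) refl (ν 1 + I₊) I₊ (eval F.x) (eval F.y) Z u ⟩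
      eval F.S₊ * (u * u) ∎
      where Z = eval F.M * eval F.y - eval F.c₊ * eval F.x

    S₋-form : eval F.c₋ * T₋ ≡ I₋ * eval F.S₋ * (u * u)
    S₋-form = begin
      eval F.c₋ * T₋
        ≡⟨ solve 5 (λ I₋ c₋ t u v → let I = con (+ 1) :+ I₋ in
             c₋ :* (I₋ :* I :* (u :* u :- t :* v)) := I₋ :* (I :* c₋ :* (u :* u) :- (c₋ :* t) :* (I :* v))) refl I₋ (eval F.c₋) t u v ⟩
      I₋ * (I * eval F.c₋ * (u * u) - (eval F.c₋ * t) * (I * v))
        ≡⟨ cong₂ (λ p q → I₋ * (I * eval F.c₋ * (u * u) - p * q)) t-form ratio ⟩
      I₋ * (I * eval F.c₋ * (u * u) - (I₋ * (eval F.M - eval F.x) * u) * (eval F.x * u))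
        ≡⟨ solve 6 (λ I₋ I c₋ M x u → I₋ :* (I :* c₋ :* (u :* u) :- (I₋ :* (M :- x) :* u) :* (x :* u)) :=
             I₋ :* (I :* c₋ :- I₋ :* (M :- x) :* x) :* (u :* u)) refl I₋ I (eval F.c₋) (eval F.M) (eval F.x) u ⟩
      I₋ * eval F.S₋ * (u * u) ∎

  -- The three forms above carry the factors `c₋`, `I` and `I * I * I₊`. The prefactor here clears
  -- both products at once, so that the difference is governed by the sign of `Q`, homogeneously of
  -- degree four in `u`.
  turán-form : I * I * I₊ * eval F.c₋ * (T₀ * T₀ - T₋ * T₊) ≡ eval F.Q * ((u * u) * (u * u))
  turán-form = begin
    I * I * I₊ * eval F.c₋ * (T₀ * T₀ - T₋ * T₊)
      ≡⟨ solve 6 (λ I I₊ c₋ T₋ T₀ T₊ → I :* I :* I₊ :* c₋ :* (T₀ :* T₀ :- T₋ :* T₊) :=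
           I₊ :* c₋ :* ((I :* T₀) :* (I :* T₀)) :- (c₋ :* T₋) :* (I :* I :* I₊ :* T₊)) refl I I₊ (eval F.c₋) T₋ T₀ T₊ ⟩
    I₊ * eval F.c₋ * ((I * T₀) * (I * T₀)) - (eval F.c₋ * T₋) * (I * I * I₊ * T₊)
      ≡⟨ cong₂ (λ p q → I₊ * eval F.c₋ * (p * p) - q) S₀-form (cong₂ _*_ S₋-form S₊-form) ⟩
    I₊ * eval F.c₋ * ((eval F.S₀ * (u * u)) * (eval F.S₀ * (u * u))) - (I₋ * eval F.S₋ * (u * u)) * (eval F.S₊ * (u * u))
      ≡⟨ solve 7 (λ I₊ c₋ S₀ I₋ S₋ S₊ U → I₊ :* c₋ :* ((S₀ :* U) :* (S₀ :* U)) :- (I₋ :* S₋ :* U) :* (S₊ :* U) :=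
           (I₊ :* c₋ :* (S₀ :* S₀) :- I₋ :* S₋ :* S₊) :* (U :* U))
           refl I₊ (eval F.c₋) (eval F.S₀) I₋ (eval F.S₋) (eval F.S₊) (u * u) ⟩
    eval F.Q * ((u * u) * (u * u)) ∎

  turán-log-concave : ∀ {s} → 0ℚ ≤ j → 0ℚ ≤ e → 0ℚ ≤ s → K ≡ e * e + ν 2 * I * e + s → T₋ * T₊ ≤ T₀ * T₀
  turán-log-concave {s} 0≤j 0≤e 0≤s K≡ =
    0≤p-q⇒q≤p (*-cancelˡ-≤-pos P ⦃ positive (0≤p-1⇒0<p {P} 0≤P-1) ⦄ 0≤P*Δ)
    where
    P = I * I * I₊ * eval F.c₋
    0≤Q : 0ℚ ≤ eval F.Q
    -- `G.Q` is `F.Q` with `kᵖ` put for `K`; its expansion in e, s, j passes the coefficient test.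
    0≤Q = subst (λ K → 0ℚ ≤ ⟦ F.Q ⟧ (e ∷ K ∷ j ∷ [])) (sym K≡) (0≤⟦ G.Q ⟧ (0≤e ∷ 0≤s ∷ 0≤j ∷ []))
    0≤P-1 : 0ℚ ≤ P - ν 1
    -- The constant coefficient of `P` is 24, so the coefficients stay nonnegative after subtracting
    -- 1.
    0≤P-1 = subst (λ K → 0ℚ ≤ I * I * I₊ * ⟦ F.c₋ ⟧ (e ∷ K ∷ j ∷ []) - ν 1) (sym K≡)
      (0≤⟦ G.i :* G.i :* G.i₊ :* G.c₋ :- G.one ⟧ (0≤e ∷ 0≤s ∷ 0≤j ∷ []))
    0≤P*Δ : P * 0ℚ ≤ P * (T₀ * T₀ - T₋ * T₊)
    0≤P*Δ = subst₂ _≤_ {0ℚ} {P * 0ℚ} {eval F.Q * (u * u * (u * u))} {P * (T₀ * T₀ - T₋ * T₊)}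
      (sym (*-zeroʳ P)) (sym turán-form) (0≤* 0≤Q (0≤p*p (u * u)))

-- The invariant of the descent: `e` is nonnegative and e² + 2 I e is at most K. The slack `s` is
-- recorded so that `K` becomes a polynomial in nonnegative quantities.
record Ratio (I K u v : ℚ) : Set where
  constructor mkRatio
  field
    {e s}  : ℚ
    0≤e    : 0ℚ ≤ e
    0≤s    : 0ℚ ≤ s
    K-form : K ≡ e * e + ν 2 * I * e + s
    ratio  : I * v ≡ (K - e) * u

-- Inserting (I + 1) w = (K - e′) v into the recurrence gives D (I v) = K₊ (M - K₊) u with D = M - K
-- + e′. As M - K₊ = D - B, the new `e` is K₊ B / D, and the new `s` is K₊ - e² - 2 I e over the
-- denominator D².
ratio-step : ∀ {N K u v w} → 0ℚ ≤ N → Recurrence N (ν 1 + K) u v w →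
  Ratio (ν 1 + (ν 1 + N)) K v w → Ratio (ν 1 + N) (ν 1 + K) u v
ratio-step {N} {K} {u} {v} {w} 0≤N rec (mkRatio {e′} {s′} 0≤e′ 0≤s′ refl ratio′) = record
  { e      = e
  ; s      = s
  ; 0≤e    = 0≤* (0≤⟦ K₊ᵖ :* Bᵖ ⟧ 0≤ρ) 0≤r
  ; 0≤s    = 0≤* (0≤⟦ K₊ᵖ :* (Dᵖ :* Dᵖ :- K₊ᵖ :* Bᵖ :* Bᵖ :- con (+ 2) :* Iᵖ :* Bᵖ :* Dᵖ) ⟧ 0≤ρ) (0≤* 0≤r 0≤r)
  ; K-form = K-form
  ; ratio  = ratio
  }
  where
  open ≡-Reasoning
  Iᵖ K₊ᵖ Bᵖ Dᵖ : Polynomial 3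
  Iᵖ  = con (+ 1) :+ var 2F
  K₊ᵖ = con (+ 1) :+ kᵖ
  Bᵖ  = con (+ 1) :+ var 0F
  Dᵖ  = con (+ 2) :* Iᵖ :+ K₊ᵖ :+ var 0F
  0≤ρ : All (0ℚ ≤_) (e′ ∷ s′ ∷ N ∷ [])
  0≤ρ = 0≤e′ ∷ 0≤s′ ∷ 0≤N ∷ []
  I = ν 1 + N
  K₊ = ν 1 + K
  B = ν 1 + e′
  D = ν 2 * I + K₊ + e′
  0<D : 0ℚ < D
  0<D = 0≤p-1⇒0<p (0≤⟦ Dᵖ :- con (+ 1) ⟧ 0≤ρ)
  instance
    D-pos : Positive D
    D-pos = positive 0<D
    D≢0 : NonZero D
    D≢0 = pos⇒nonZero D
  r = 1/ D
  0≤r : 0ℚ ≤ r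
  0≤r = <⇒≤ (positive⁻¹ r ⦃ 1/pos⇒pos D ⦄)
  e = K₊ * B * r
  s = K₊ * (D * D - K₊ * B * B - ν 2 * I * B * D) * (r * r)
  D*r≡1 : D * r ≡ ν 1
  D*r≡1 = *-inverseʳ D
  K-form : K₊ ≡ e * e + ν 2 * I * e + s
  K-form = begin
    K₊
      -- Factors 1 and a vanishing term are inserted, so that replacing 1 by `D * r` brings
      -- everything over D².
      ≡⟨ solve 4 (λ K₊ I B r → K₊ := K₊ :* (con (+ 1) :* con (+ 1)) :+ con (+ 2) :* I :* K₊ :* B :* r :* (con (+ 1) :- con (+ 1))) refl K₊ I B r ⟩
    K₊ * (ν 1 * ν 1) + ν 2 * I * K₊ * B * r * (ν 1 - ν 1)
      ≡⟨ cong (λ x → K₊ * (x * x) + ν 2 * I * K₊ * B * r * (ν 1 - x)) D*r≡1 ⟨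
    K₊ * (D * r * (D * r)) + ν 2 * I * K₊ * B * r * (ν 1 - D * r)
      ≡⟨ solve 5 (λ K₊ I B D r → let e = K₊ :* B :* r in
           K₊ :* (D :* r :* (D :* r)) :+ con (+ 2) :* I :* K₊ :* B :* r :* (con (+ 1) :- D :* r) :=
           e :* e :+ con (+ 2) :* I :* e :+ K₊ :* (D :* D :- K₊ :* B :* B :- con (+ 2) :* I :* B :* D) :* (r :* r))
           refl K₊ I B D r ⟩
    e * e + ν 2 * I * e + s ∎
  M = ν 2 * (I + K₊) - ν 1
  ratio : I * v ≡ (K₊ - e) * u
  ratio = begin
    I * v                                           ≡⟨ *-identityˡ (I * v) ⟨
    ν 1 * (I * v)                                   ≡⟨ cong (_* (I * v)) D*r≡1 ⟨
    D * r * (I * v)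
      ≡⟨ solve 5 (λ N K e′ r v → let I = con (+ 1) :+ N; K₊ = con (+ 1) :+ K; D = con (+ 2) :* I :+ K₊ :+ e′; M = con (+ 2) :* (I :+ K₊) :- con (+ 1) in
           D :* r :* (I :* v) := r :* (M :* I :* v :- I :* ((K :- e′) :* v))) refl N K e′ r v ⟩
    r * (M * I * v - I * ((K - e′) * v))            ≡⟨ cong (λ x → r * (M * I * v - I * x)) ratio′ ⟨
    r * (M * I * v - I * ((ν 1 + I) * w))           ≡⟨ cong (λ x → r * (M * I * v - x)) (sym (*-assoc I (ν 1 + I) w)) ⟩
    r * (M * I * v - I * (ν 1 + I) * w)             ≡⟨ cong (λ x → r * (M * I * v - x)) rec ⟩
    r * (M * I * v - (M * I * v - K₊ * (M - K₊) * u))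
      ≡⟨ solve 6 (λ N K e′ r u v → let I = con (+ 1) :+ N; K₊ = con (+ 1) :+ K; D = con (+ 2) :* I :+ K₊ :+ e′; M = con (+ 2) :* (I :+ K₊) :- con (+ 1) in
           r :* (M :* I :* v :- (M :* I :* v :- K₊ :* (M :- K₊) :* u)) := (K₊ :* (D :* r) :- K₊ :* (con (+ 1) :+ e′) :* r) :* u) refl N K e′ r u v ⟩
    (K₊ * (D * r) - e) * u                          ≡⟨ cong (λ x → (K₊ * x - e) * u) D*r≡1 ⟩
    (K₊ * ν 1 - e) * u                              ≡⟨ cong (λ x → (x - e) * u) (*-identityʳ K₊) ⟩
    (K₊ - e) * u                                    ∎

-- Reduction of log-concavity to interior indices.

module _ {m} (a : Vector ℚ m) where

  extendByZero-toℕ : (b : ℕ → ℚ) → (∀ j → a j ≡ b (toℕ j)) → ∀ {n} → n ℕ.< m → extendByZero a (+ n) ≡ b n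
  extendByZero-toℕ b a≡b {n} n<m with n ℕ.<? m
  ... | yes n<m′ = trans (a≡b (fromℕ< n<m′)) (cong b (toℕ-fromℕ< n<m′))
  ... | no  n≮m  = contradiction n<m n≮m

  extendByZero-≥ : ∀ {n} → n ℕ.≥ m → extendByZero a (+ n) ≡ 0ℚ
  extendByZero-≥ {n} n≥m with n ℕ.<? m
  ... | yes n<m = contradiction n<m (ℕ.≤⇒≯ n≥m)
  ... | no  _   = refl

  -- At either end one neighbour is 0 by convention, and the claim is that a square is nonnegative.
  LogConcave-toℕ : (b : ℕ → ℚ) → (∀ j → a j ≡ b (toℕ j)) →
    (∀ n → 2 ℕ.+ n ℕ.< m → b n * b (2 ℕ.+ n) ≤ b (1 ℕ.+ n) * b (1 ℕ.+ n)) → LogConcave a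
  LogConcave-toℕ b a≡b b-log-concave j =
    subst (λ x → a′ (ℤ.pred (+ toℕ j)) * a′ (ℤ.suc (+ toℕ j)) ≤ x * x) (sym (a≡b j)) (main (toℕ j) (toℕ<n j))
    where
    a′ = extendByZero a
    main : ∀ n → n ℕ.< m → a′ (ℤ.pred (+ n)) * a′ (ℤ.suc (+ n)) ≤ b n * b n
    main zero    _     = subst (_≤ b 0 * b 0) (sym (*-zeroˡ (a′ (+ 1)))) (0≤p*p (b 0))
    main (suc n) 1+n<m with ℕ.<-≤-connex (2 ℕ.+ n) m
    ... | inj₁ 2+n<m = subst₂ (λ x y → x * y ≤ b (1 ℕ.+ n) * b (1 ℕ.+ n))
      (sym (extendByZero-toℕ b a≡b (ℕ.<⇒≤ 1+n<m))) (sym (extendByZero-toℕ b a≡b 2+n<m)) (b-log-concave n 2+n<m)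
    ... | inj₂ m≤2+n = subst (_≤ b (1 ℕ.+ n) * b (1 ℕ.+ n))
      (sym (trans (cong (a′ (+ n) *_) (extendByZero-≥ m≤2+n)) (*-zeroʳ (a′ (+ n))))) (0≤p*p (b (1 ℕ.+ n)))

-- The abstract results applied to the Boros-Moll numbers.

module _ (m : ℕ) where
  open BorosMoll m

  private
    D : ℕ → ℚ
    D n = d (+ n) m

  -- `N` and `K` are tied to `n` and `k` only by equations, so that callers may present them as sums
  -- with `ν 1`, the shape the abstract lemmas expect.
  d-recurrence : ∀ n k {N K} → ν n ≡ N → ν k ≡ K → n ℕ.+ k ≡ m →
    Recurrence N K (D n) (D (1 ℕ.+ n)) (D (2 ℕ.+ n))
  d-recurrence n k {N} {K} refl refl n+k≡m = begin
    (ν 1 + N) * (ν 1 + (ν 1 + N)) * D (2 ℕ.+ n)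
      ≡⟨ solve 2 (λ N d → (con (+ 1) :+ N) :* (con (+ 1) :+ (con (+ 1) :+ N)) :* d := (con (+ 1) :+ N) :* (con (+ 2) :+ N) :* d)
           refl N (D (2 ℕ.+ n)) ⟩
    (ν 1 + N) * (ν 2 + N) * D (2 ℕ.+ n)
      ≡⟨ recurrence n ⟩
    (ν 1 + ν 2 * μ) * (ν 1 + N) * D (1 ℕ.+ n) - (μ * (ν 1 + μ) - N * (ν 1 + N)) * D n
      ≡⟨ cong (λ x → (ν 1 + ν 2 * x) * (ν 1 + N) * D (1 ℕ.+ n) - (x * (ν 1 + x) - N * (ν 1 + N)) * D n)
           (trans (cong ν (sym n+k≡m)) (ν-+ n k)) ⟩
    (ν 1 + ν 2 * (N + K)) * (ν 1 + N) * D (1 ℕ.+ n) - ((N + K) * (ν 1 + (N + K)) - N * (ν 1 + N)) * D n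
      ≡⟨ solve 4 (λ N K p q → let I = con (+ 1) :+ N; M = con (+ 2) :* (I :+ K) :- con (+ 1) in
           (con (+ 1) :+ con (+ 2) :* (N :+ K)) :* I :* q :- ((N :+ K) :* (con (+ 1) :+ (N :+ K)) :- N :* I) :* p :=
           M :* I :* q :- K :* (M :- K) :* p) refl N K (D n) (D (1 ℕ.+ n)) ⟩
    M * (ν 1 + N) * D (1 ℕ.+ n) - K * (M - K) * D n ∎
    where
    open ≡-Reasoning
    M = ν 2 * ((ν 1 + N) + K) - ν 1

  -- Descent in n, as induction on k = m - n. At k = 0 the value d_{m+1} = 0 allows e = s = 0.
  d-ratio : ∀ k n {N K} → ν n ≡ N → ν k ≡ K → n ℕ.+ k ≡ m → Ratio (ν 1 + N) K (D n) (D (1 ℕ.+ n))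
  d-ratio zero n {N} refl refl n+0≡m = record
    { e      = 0ℚ
    ; s      = 0ℚ
    ; 0≤e    = ≤-refl
    ; 0≤s    = ≤-refl
    ; K-form = solve 1 (λ I → con (+ 0) := con (+ 0) :* con (+ 0) :+ con (+ 2) :* I :* con (+ 0) :+ con (+ 0)) refl (ν 1 + N)
    ; ratio  = begin
        (ν 1 + N) * D (1 ℕ.+ n)   ≡⟨ cong (λ x → (ν 1 + N) * D (1 ℕ.+ x)) (trans (sym (ℕ.+-identityʳ n)) n+0≡m) ⟩
        (ν 1 + N) * D (1 ℕ.+ m)   ≡⟨ cong ((ν 1 + N) *_) d[1+m]≡0 ⟩
        (ν 1 + N) * ν 0           ≡⟨ solve 2 (λ I u → I :* con (+ 0) := (con (+ 0) :- con (+ 0)) :* u) refl (ν 1 + N) (D n) ⟩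
        (ν 0 - ν 0) * D n         ∎
    }
    where open ≡-Reasoning
  d-ratio (suc k) n refl refl n+1+k≡m =
    subst (λ K → Ratio (ν 1 + ν n) K (D n) (D (1 ℕ.+ n))) (sym (ν-suc k))
      (ratio-step (0≤ι n) (d-recurrence n (suc k) refl (ν-suc k) n+1+k≡m)
        (d-ratio k (suc n) (ν-suc n) refl (trans (sym (ℕ.+-suc n k)) n+1+k≡m)))

  W : ℕ → ℚ
  W i = turán (ν i) (D (ℕ.pred i)) (D i) (D (suc i))

  W-log-concave : ∀ n → 3 ℕ.+ n ℕ.≤ m → W (1 ℕ.+ n) * W (3 ℕ.+ n) ≤ W (2 ℕ.+ n) * W (2 ℕ.+ n)
  W-log-concave n 3+n≤m = begin
    W (1 ℕ.+ n) * W (3 ℕ.+ n)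
      ≡⟨ cong₂ (λ x y → turán x (D n) (D (1 ℕ.+ n)) (D (2 ℕ.+ n)) * turán y (D (2 ℕ.+ n)) (D (3 ℕ.+ n)) (D (4 ℕ.+ n))) 1+n 3+n ⟩
    turán (ν 1 + ν n) (D n) (D (1 ℕ.+ n)) (D (2 ℕ.+ n)) * turán (ν 1 + (ν 1 + (ν 1 + ν n))) (D (2 ℕ.+ n)) (D (3 ℕ.+ n)) (D (4 ℕ.+ n))
      ≤⟨ turán-log-concave
           (d-recurrence n (2 ℕ.+ k) refl (ν-suc (1 ℕ.+ k)) n+2+k≡m)
           (d-recurrence (1 ℕ.+ n) (1 ℕ.+ k) 1+n refl 1+n+1+k≡m)
           (d-recurrence (2 ℕ.+ n) k 2+n k≡ 2+n+k≡m)
           (Ratio.ratio rat) (0≤ι n) (Ratio.0≤e rat) (Ratio.0≤s rat) (Ratio.K-form rat) ⟩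
    turán (ν 1 + (ν 1 + ν n)) (D (1 ℕ.+ n)) (D (2 ℕ.+ n)) (D (3 ℕ.+ n)) * turán (ν 1 + (ν 1 + ν n)) (D (1 ℕ.+ n)) (D (2 ℕ.+ n)) (D (3 ℕ.+ n))
      ≡⟨ cong (λ x → turán x (D (1 ℕ.+ n)) (D (2 ℕ.+ n)) (D (3 ℕ.+ n)) * turán x (D (1 ℕ.+ n)) (D (2 ℕ.+ n)) (D (3 ℕ.+ n))) 2+n ⟨
    W (2 ℕ.+ n) * W (2 ℕ.+ n) ∎
    where
    open ≤-Reasoning
    -- The central index is i = n + 2, so `k` is m - i, and `1 + k` is the `K` = m + 1 - i of the
    -- abstract lemma.
    k = m ∸ (2 ℕ.+ n)
    2+n+k≡m : 2 ℕ.+ n ℕ.+ k ≡ m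
    2+n+k≡m = ℕ.m+[n∸m]≡n (ℕ.<⇒≤ 3+n≤m)
    1+n+1+k≡m : 1 ℕ.+ n ℕ.+ (1 ℕ.+ k) ≡ m
    1+n+1+k≡m = trans (ℕ.+-suc (1 ℕ.+ n) k) 2+n+k≡m
    n+2+k≡m : n ℕ.+ (2 ℕ.+ k) ≡ m
    n+2+k≡m = trans (ℕ.+-suc n (1 ℕ.+ k)) 1+n+1+k≡m
    1+n : ν (1 ℕ.+ n) ≡ ν 1 + ν n
    1+n = ν-suc n
    2+n : ν (2 ℕ.+ n) ≡ ν 1 + (ν 1 + ν n)
    2+n = trans (ν-suc (1 ℕ.+ n)) (cong (λ x → ν 1 + x) 1+n)
    3+n : ν (3 ℕ.+ n) ≡ ν 1 + (ν 1 + (ν 1 + ν n))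
    3+n = trans (ν-suc (2 ℕ.+ n)) (cong (λ x → ν 1 + x) 2+n)
    k≡ : ν k ≡ ν (1 ℕ.+ k) - ν 1
    k≡ = trans (solve 1 (λ k → k := con (+ 1) :+ k :- con (+ 1)) refl (ν k)) (cong (_- ν 1) (sym (ν-suc k)))
    rat = d-ratio (1 ℕ.+ k) (1 ℕ.+ n) 1+n refl 1+n+1+k≡m

  weightedTurán≡W : ∀ j → weightedTurán m j ≡ W (suc (toℕ j))
  weightedTurán≡W j = cong (_* (D (suc n) * D (suc n) - D n * D (2 ℕ.+ n)))
    (trans (ι-* (+ suc n) (+ (2 ℕ.+ n))) (cong (ν (suc n) *_) (ν-suc (suc n))))
    where n = toℕ j

theorem1p7 : (m : ℕ) → m ≥ 2 → LogConcave (weightedTurán m)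
theorem1p7 m _ = LogConcave-toℕ (weightedTurán m) (λ n → W m (suc n)) (weightedTurán≡W m) (W-log-concave m)
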